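{- For every finite simple connected graph $G$ it holds that $\operatorname{diam}(G) \leq \gamma_{cg}(G) + 1$ and $\operatorname{diam}(G) \leq \gamma_{cg}'(G)$.
   Context: The connected domination game on a graph $G$ is played by two players, Dominator and Staller, who alternately select vertices. A vertex $w$ is a legal move if (a) its closed neighborhood $N[w]$ contains at least one vertex not in the union of the closed neighborhoods of the previously selected vertices (i.e. it dominates a new vertex), and (b) unless it is the first move, $w$ is adjacent to at least one already selected vertex. The game ends when no legal move exists; on a connected graph the selected vertices then form a connected dominating set. Dominator wants to minimize the total number of moves, Staller wants to maximize it. $\gamma_{cg}(G)$ is the number of moves under optimal play when Dominator moves first (D-game), and $\gamma_{cg}'(G)$ is the number of moves under optimal play when Staller moves first (S-game). -}

module Defs where

open import Data.Fin using (Fin; _≟_)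
open import Data.Fin.Properties using (any?)
open import Data.Fin.Subset using (Subset; _∈_; _∉_; _∪_; ⁅_⁆; _⊂_; Empty; ⊥)
open import Data.Fin.Subset.Properties
  using (_∈?_; nonempty?; p⊆p∪q; q⊆p∪q; x∈⁅x⁆)
open import Data.Fin.Subset.Induction using (Acc; acc; ⊃-wellFounded)
open import Data.List using (List; []; _∷_; map; mapMaybe; allFin; cartesianProduct)
open import Data.List.Extrema.Nat using (min; max)
open import Data.Maybe using (Maybe)
import Data.Maybe as Maybe
open import Data.Nat using (ℕ; zero; suc; _≤_; z≤n; s≤s)
open import Data.Product using (∃; _×_; _,_; proj₁; uncurry)
open import Data.Sum using (_⊎_)
open import Level using (0ℓ)
open import Relation.Binary using (Rel; Symmetric; Irreflexive)
import Relation.Binary as Binary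
open import Relation.Binary.PropositionalEquality using (_≡_; refl)
open import Relation.Nullary using (¬_; Dec; yes; no; contradiction)
open import Relation.Nullary.Decidable
  using (map′; dec⇒maybe; ¬?; _×-dec_; _⊎-dec_)
open import Relation.Unary using (Pred)
import Relation.Unary as Unary

record Graph : Set₁ where
  field
    order  : ℕ
    Adj    : Rel (Fin order) 0ℓ
    adj?   : Binary.Decidable Adj
    sym    : Symmetric Adj
    irrefl : Irreflexive _≡_ Adj

  Vertex : Set
  Vertex = Fin order

open Graph using (Vertex)

module _ (G : Graph) where
  open Graph G using (Adj; adj?)

  data Walk : Vertex G → Vertex G → ℕ → Set where
    []  : ∀ {u} → Walk u u zero
    _∷_ : ∀ {u v w k} → Adj u v → Walk v w k → Walk u w (suc k)

  Connected : Set
  Connected = ∀ u v → ∃ (Walk u v)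

  walk? : ∀ u v k → Dec (Walk u v k)
  walk? u v zero    = map′ (λ { refl → [] }) (λ { [] → refl }) (u ≟ v)
  walk? u v (suc k) =
    map′ (λ { (_ , e , p) → e ∷ p }) (λ { (e ∷ p) → _ , e , p })
         (any? λ w → adj? u w ×-dec walk? w v k)

least : ∀ {P : Pred ℕ 0ℓ} → Unary.Decidable P → ∀ k → P k →
        ∃ λ m → P m × (∀ j → P j → m ≤ j)
least     P? zero    p = zero , p , λ _ _ → z≤n
least {P} P? (suc k) p with P? zero
... | yes p₀ = zero , p₀ , λ _ _ → z≤n
... | no ¬p₀ = step (least (λ j → P? (suc j)) k p)
  where
  bound : ∀ {m} → (∀ j → P (suc j) → m ≤ j) → ∀ j → P j → suc m ≤ j
  bound h zero    q = contradiction q ¬p₀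
  bound h (suc j) q = s≤s (h j q)

  step : (∃ λ m → P (suc m) × (∀ j → P (suc j) → m ≤ j)) →
         ∃ λ m → P m × (∀ j → P j → m ≤ j)
  step (m , q , h) = suc m , q , bound h

dist : (G : Graph) → Connected G → Vertex G → Vertex G → ℕ
dist G conn u v = proj₁ (uncurry (least (walk? G u v)) (conn u v))

-- The first argument of max is only a base value, harmless as distances
-- are natural numbers; it makes the diameter of the graph of order 0 zero.
diam : (G : Graph) → Connected G → ℕ
diam G conn =
  max 0 (map (uncurry (dist G conn)) (cartesianProduct vertices vertices))
  where
  vertices : List (Vertex G)
  vertices = allFin (Graph.order G)

data Player : Set where
  Dominator Staller : Player

opponent : Player → Player
opponent Dominator = Staller
opponent Staller   = Dominator

-- Number of moves from a position, given the list of numbers of moves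
-- that follow each legal move; the list is empty when the game is over.
optimal : Player → List ℕ → ℕ
optimal _         []       = 0
optimal Dominator (k ∷ ks) = suc (min k ks)
optimal Staller   (k ∷ ks) = suc (max k ks)

module _ (G : Graph) where
  open Graph G using (order; Adj; adj?)

  N[_] : Vertex G → Pred (Vertex G) 0ℓ
  N[ w ] x = x ≡ w ⊎ Adj w x

  -- A position is the set S of vertices selected so far.
  Dominated : Subset order → Pred (Vertex G) 0ℓ
  Dominated S x = ∃ λ y → y ∈ S × N[ y ] x

  Legal : Subset order → Pred (Vertex G) 0ℓ
  Legal S w = (∃ λ x → N[ w ] x × ¬ Dominated S x)
            × (Empty S ⊎ (∃ λ y → y ∈ S × Adj w y))

  closedNbr? : ∀ w → Unary.Decidable N[ w ]
  closedNbr? w x = (x ≟ w) ⊎-dec adj? w x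

  dominated? : ∀ S → Unary.Decidable (Dominated S)
  dominated? S x = any? λ y → (y ∈? S) ×-dec closedNbr? y x

  legal? : ∀ S → Unary.Decidable (Legal S)
  legal? S w = any? (λ x → closedNbr? w x ×-dec ¬? (dominated? S x))
         ×-dec (¬? (nonempty? S) ⊎-dec any? (λ y → (y ∈? S) ×-dec adj? w y))

  legal⇒∉ : ∀ {S w} → Legal S w → w ∉ S
  legal⇒∉ {w = w} ((_ , x∈N[w] , x-new) , _) w∈S = x-new (w , w∈S , x∈N[w])

  legal⇒⊂ : ∀ {S w} → Legal S w → S ⊂ S ∪ ⁅ w ⁆
  legal⇒⊂ {S} {w} l =
    p⊆p∪q ⁅ w ⁆ , w , q⊆p∪q S ⁅ w ⁆ (x∈⁅x⁆ w) , legal⇒∉ l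

  -- Minimax value: the number of further moves from position S under
  -- optimal play, with the given player to move. The accessibility proof
  -- only justifies the recursion (S grows with every move).
  movesFrom : Player → (S : Subset order) →
              Acc (λ T U → U ⊂ T) S → ℕ
  movesFrom p S (acc rs) = optimal p (mapMaybe afterMove (allFin order))
    where
    afterMove : Vertex G → Maybe ℕ
    afterMove w =
      Maybe.map (λ l → movesFrom (opponent p) (S ∪ ⁅ w ⁆) (rs (legal⇒⊂ l)))
                (dec⇒maybe (legal? S w))

  γcg : ℕ
  γcg = movesFrom Dominator ⊥ (⊃-wellFounded ⊥)

  γcg′ : ℕ
  γcg′ = movesFrom Staller ⊥ (⊃-wellFounded ⊥)

{-# OPTIONS --safe #-}
-- Every play ends in a set T that dominates the graph and in which any two
-- vertices are at distance at most |T| - 1, since each move after the first is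
-- adjacent to an earlier one. Any two vertices of the graph are in the closed
-- neighbourhoods of two vertices of T, hence at distance at most |T| + 1. In the
-- S-game Staller may open at an end u of a diametral path; then u itself lies in
-- T, which saves one step.
module Submission where

open import Defs
open import Data.Empty using (⊥-elim)
open import Data.Fin.Subset using (Subset; _∈_; _⊆_; _⊂_; _∪_; ⁅_⁆; ⊥)
open import Data.Fin.Subset.Induction using (Acc; acc; ⊃-wellFounded)
open import Data.Fin.Subset.Properties
  using (∉⊥; x∈p∪q⁻; x∈⁅y⁆⇒x≡y; x∈⁅x⁆; p⊆p∪q; q⊆p∪q; ⊆-refl; ⊆-trans)
open import Data.List using (List; []; _∷_; map; mapMaybe; allFin; cartesianProduct)
open import Data.List.Extrema.Nat using (max≤v⁺; argmin-sel; argmax-sel; ⊥≤max; xs≤max)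
import Data.List.Membership.Propositional as List
open import Data.List.Membership.Propositional.Properties using (∈-allFin; ∈-map⁻)
open import Data.List.Relation.Unary.All as All using ()
open import Data.List.Relation.Unary.Any using (here; there)
import Data.Maybe as Maybe
open import Data.Nat using (ℕ; suc; _≤_; _+_; z≤n; s≤s)
open import Data.Nat.Properties
  using (≤-refl; ≤-reflexive; ≤-trans; +-mono-≤; +-comm; +-suc; +-identityʳ; n≤1+n)
open import Data.Product using (∃; _×_; _,_; proj₂; uncurry)
open import Data.Sum using (_⊎_; inj₁; inj₂)
open import Level using (0ℓ)
open import Relation.Binary.PropositionalEquality
  using (_≡_; refl; sym; trans; cong; subst)
open import Relation.Nullary using (¬_; yes; no)
open import Relation.Nullary.Decidable using (dec⇒maybe)
open import Relation.Unary using (Pred; Decidable)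

-- Minima and maxima of nonempty lists are attained, so a single optimal play can be followed
-- regardless of whose turn it is.
optimal-∈ : ∀ p k ks → ∃ λ x → x List.∈ k ∷ ks × optimal p (k ∷ ks) ≡ suc x
optimal-∈ Dominator k ks with argmin-sel (λ x → x) k ks
... | inj₁ eq = _ , here eq , refl
... | inj₂ i  = _ , there i , refl
optimal-∈ Staller k ks with argmax-sel (λ x → x) k ks
... | inj₁ eq = _ , here eq , refl
... | inj₂ i  = _ , there i , refl

∈⇒≤-optimal-Staller : ∀ {x xs} → x List.∈ xs → suc x ≤ optimal Staller xs
∈⇒≤-optimal-Staller {xs = k ∷ ks} (here refl) = s≤s (⊥≤max k ks)
∈⇒≤-optimal-Staller {xs = k ∷ ks} (there i)   = s≤s (All.lookup (xs≤max k ks) i)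

module _ {A : Set} {L : Pred A 0ℓ} (L? : Decidable L) (f : ∀ w → L w → ℕ) where

  -- Shaped like the list of continuations in `movesFrom`, so that facts about it apply to the game
  -- by unfolding alone.
  values : List A → List ℕ
  values = mapMaybe λ w → Maybe.map (f w) (dec⇒maybe (L? w))

  ∈-values⁻ : ∀ {x} ws → x List.∈ values ws → ∃ λ w → ∃ λ l → x ≡ f w l
  ∈-values⁻ (w ∷ ws) i with L? w
  ∈-values⁻ (w ∷ ws) (here refl) | yes l = w , l , refl
  ∈-values⁻ (w ∷ ws) (there i)   | yes l = ∈-values⁻ ws i
  ∈-values⁻ (w ∷ ws) i           | no _  = ∈-values⁻ ws i

  -- The proof `l` in the conclusion is the one returned by `L?`, which may differ from the given
  -- one, and `f` may depend on it.
  ∈-values⁺ : ∀ {w} ws → w List.∈ ws → L w → ∃ λ l → f w l List.∈ values ws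
  ∈-values⁺ (w ∷ ws) i l with L? w
  ∈-values⁺ (w ∷ ws) (here refl) _ | yes l  = l , here refl
  ∈-values⁺ (w ∷ ws) (here refl) l | no ¬l  = ⊥-elim (¬l l)
  ∈-values⁺ (w ∷ ws) (there i)   l | yes _  =
    let l′ , j = ∈-values⁺ ws i l in l′ , there j
  ∈-values⁺ (w ∷ ws) (there i)   l | no _   = ∈-values⁺ ws i l

  optimal-values : ∀ p ws →
    ((∀ {w} → w List.∈ ws → ¬ L w) × optimal p (values ws) ≡ 0)
    ⊎ (∃ λ w → ∃ λ l → optimal p (values ws) ≡ suc (f w l))
  optimal-values p ws with values ws in eq
  ... | [] = inj₁ (none , refl)
    where
    none : ∀ {w} → w List.∈ ws → ¬ L w
    none i l with ∈-values⁺ ws i l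
    ... | _ , j with subst (_ List.∈_) eq j
    ... | ()
  ... | k ∷ ks =
    let x , i , opt = optimal-∈ p k ks
        w , l , x≡  = ∈-values⁻ ws (subst (x List.∈_) (sym eq) i)
    in inj₂ (w , l , trans opt (cong suc x≡))

module _ (G : Graph) where
  open Graph G using (order; Adj; Vertex)

  -- An upper bound on distance phrased by walks, so that bounds add under concatenation and no
  -- least length has to be handled.
  Within : ℕ → Vertex → Vertex → Set
  Within k u v = ∃ λ j → j ≤ k × Walk G u v j

  within-refl : ∀ {u k} → Within k u u
  within-refl = 0 , z≤n , []

  within-adj : ∀ {u v} → Adj u v → Within 1 u v
  within-adj e = 1 , ≤-refl , e ∷ []

  within-mono : ∀ {k l u v} → k ≤ l → Within k u v → Within l u v
  within-mono k≤l (j , j≤k , p) = j , ≤-trans j≤k k≤l , p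

  walk-++ : ∀ {u v w j k} → Walk G u v j → Walk G v w k → Walk G u w (j + k)
  walk-++ []      q = q
  walk-++ (e ∷ p) q = e ∷ walk-++ p q

  within-trans : ∀ {k l u v w} → Within k u v → Within l v w → Within (k + l) u w
  within-trans (_ , j≤k , p) (_ , i≤l , q) = _ , +-mono-≤ j≤k i≤l , walk-++ p q

  within-N[] : ∀ {x y} → N[_] G y x → Within 1 y x
  within-N[] (inj₁ refl) = within-refl
  within-N[] (inj₂ e)    = within-adj e

  within-N[]˘ : ∀ {x y} → N[_] G y x → Within 1 x y
  within-N[]˘ (inj₁ refl) = within-refl
  within-N[]˘ (inj₂ e)    = within-adj (Graph.sym G e)

  dist-≤ : ∀ (conn : Connected G) {u v k} → Within k u v → dist G conn u v ≤ k
  dist-≤ conn {u} {v} (j , j≤k , p) =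
    ≤-trans (proj₂ (proj₂ (uncurry (least (walk? G u v)) (conn u v))) j p) j≤k

  diam-≤ : ∀ (conn : Connected G) {k} → (∀ u v → Within k u v) → diam G conn ≤ k
  diam-≤ conn {k} h = max≤v⁺ z≤n (All.tabulate bound)
    where
    pairs = cartesianProduct (allFin order) (allFin order)

    bound : ∀ {d} → d List.∈ map (uncurry (dist G conn)) pairs → d ≤ k
    bound i with ∈-map⁻ (uncurry (dist G conn)) i
    ... | (u , v) , _ , refl = dist-≤ conn (h u v)

  -- Bounds the diameter of S in the metric of G, not of the induced subgraph.
  Spread : Subset order → ℕ → Set
  Spread S k = ∀ {y z} → y ∈ S → z ∈ S → Within k y z

  Dominating : Subset order → Set
  Dominating S = ∀ x → Dominated G S x

  spread-⁅⁆ : ∀ w → Spread (⊥ ∪ ⁅ w ⁆) 0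
  spread-⁅⁆ w y∈ z∈ with x∈p∪q⁻ ⊥ ⁅ w ⁆ y∈ | x∈p∪q⁻ ⊥ ⁅ w ⁆ z∈
  ... | inj₁ y∈⊥ | _        = ⊥-elim (∉⊥ y∈⊥)
  ... | _        | inj₁ z∈⊥ = ⊥-elim (∉⊥ z∈⊥)
  ... | inj₂ y∈w | inj₂ z∈w with x∈⁅y⁆⇒x≡y w y∈w | x∈⁅y⁆⇒x≡y w z∈w
  ... | refl | refl = within-refl

  -- Every vertex of `S` is within `k` of `v`, and the edge between `w` and `v` costs one more step.
  spread-∪ : ∀ {S k w v} → Spread S k → v ∈ S → Adj w v → Spread (S ∪ ⁅ w ⁆) (suc k)
  spread-∪ {S} {k} {w} sp v∈S e y∈ z∈ with x∈p∪q⁻ S ⁅ w ⁆ y∈ | x∈p∪q⁻ S ⁅ w ⁆ z∈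
  ... | inj₁ y∈S | inj₁ z∈S = within-mono (n≤1+n k) (sp y∈S z∈S)
  ... | inj₁ y∈S | inj₂ z∈w with x∈⁅y⁆⇒x≡y w z∈w
  ... | refl = within-mono (≤-reflexive (+-comm k 1))
                 (within-trans (sp y∈S v∈S) (within-adj (Graph.sym G e)))
  spread-∪ {w = w} sp v∈S e y∈ z∈ | inj₂ y∈w | inj₁ z∈S with x∈⁅y⁆⇒x≡y w y∈w
  ... | refl = within-trans (within-adj e) (sp v∈S z∈S)
  spread-∪ {w = w} sp v∈S e y∈ z∈ | inj₂ y∈w | inj₂ z∈w
    with x∈⁅y⁆⇒x≡y w y∈w | x∈⁅y⁆⇒x≡y w z∈w
  ... | refl | refl = within-refl

  -- One step from `u` into `T`, at most `k` steps between the two dominators, one step out to `v`.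
  within-dominating : ∀ {T k} → Spread T k → Dominating T → ∀ u v →
                      Within (suc (suc k)) u v
  within-dominating {k = k} sp dom u v =
    let y , y∈T , yu = dom u
        z , z∈T , zv = dom v
    in within-mono (s≤s (≤-reflexive (+-comm k 1)))
         (within-trans (within-N[]˘ yu) (within-trans (sp y∈T z∈T) (within-N[] zv)))

  -- If `x` is in `S`, it dominates `x′` itself. Otherwise `x` has a neighbour in `S`, so with `x′`
  -- undominated `x` would be a legal move.
  dominated-adj : ∀ {S x x′} → (∀ w → ¬ Legal G S w) →
                  Dominated G S x → Adj x x′ → Dominated G S x′
  dominated-adj {S} {x} {x′} stuck (y , y∈S , yx) e with dominated? G S x′ | yx
  ... | yes d | _         = d
  ... | no _  | inj₁ refl = x , y∈S , inj₂ e
  ... | no ¬d | inj₂ yx′  =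
    ⊥-elim (stuck x ((x′ , inj₂ e , ¬d) , inj₂ (y , y∈S , Graph.sym G yx′)))

  dominated-walk : ∀ {S x x′ k} → (∀ w → ¬ Legal G S w) →
                   Dominated G S x → Walk G x x′ k → Dominated G S x′
  dominated-walk stuck d []      = d
  dominated-walk stuck d (e ∷ p) = dominated-walk stuck (dominated-adj stuck d e) p

  stuck⇒dominating : ∀ {S y} → Connected G → y ∈ S → (∀ w → ¬ Legal G S w) →
                     Dominating S
  stuck⇒dominating {y = y} conn y∈S stuck x =
    dominated-walk stuck (y , y∈S , inj₁ refl) (proj₂ (conn y x))

  legal-⊥ : ∀ w → Legal G ⊥ w
  legal-⊥ w = (w , inj₁ refl , λ (_ , y∈⊥ , _) → ∉⊥ y∈⊥) , inj₁ λ (_ , y∈⊥) → ∉⊥ y∈⊥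

  _⊃_ : Subset order → Subset order → Set
  T ⊃ U = U ⊂ T

  ∈-after : ∀ (S : Subset order) w → w ∈ S ∪ ⁅ w ⁆
  ∈-after S w = q⊆p∪q S ⁅ w ⁆ (x∈⁅x⁆ w)

  -- The move `w` is an optimal one. The accessibility proof is in constructor form so that
  -- `movesFrom` unfolds.
  movesFrom-cases : ∀ p S (rs : ∀ {T} → T ⊃ S → Acc _⊃_ T) →
    ((∀ w → ¬ Legal G S w) × movesFrom G p S (acc rs) ≡ 0)
    ⊎ (∃ λ w → ∃ λ (l : Legal G S w) → movesFrom G p S (acc rs) ≡
         suc (movesFrom G (opponent p) (S ∪ ⁅ w ⁆) (rs (legal⇒⊂ G l))))
  movesFrom-cases p S rs with optimal-values (legal? G S)
    (λ w l → movesFrom G (opponent p) (S ∪ ⁅ w ⁆) (rs (legal⇒⊂ G l))) p (allFin order)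
  ... | inj₁ (none , eq) = inj₁ ((λ w → none (∈-allFin w)) , eq)
  ... | inj₂ step        = inj₂ step

  -- T is the final set of an optimal play from S.
  final-set : Connected G → ∀ p S (a : Acc _⊃_ S) {y k} → y ∈ S → Spread S k →
              ∃ λ T → S ⊆ T × Dominating T × Spread T (k + movesFrom G p S a)
  final-set conn p S (acc rs) {k = k} y∈S sp with movesFrom-cases p S rs
  ... | inj₁ (stuck , eq) rewrite eq | +-identityʳ k =
    S , ⊆-refl , stuck⇒dominating conn y∈S stuck , sp
  -- The vertex `y` rules out the exemption for first moves, so `w` has a neighbour in `S` and the
  -- spread grows by at most one.
  ... | inj₂ (w , (_ , inj₁ empty) , eq) = ⊥-elim (empty (_ , y∈S))
  ... | inj₂ (w , l@(_ , inj₂ (v , v∈S , e)) , eq)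
    rewrite eq | +-suc k (movesFrom G (opponent p) (S ∪ ⁅ w ⁆) (rs (legal⇒⊂ G l))) =
    let T , S∪w⊆T , dom , spT =
          final-set conn (opponent p) (S ∪ ⁅ w ⁆) (rs (legal⇒⊂ G l))
            (∈-after S w) (spread-∪ sp v∈S e)
    in T , ⊆-trans (p⊆p∪q ⁅ w ⁆) S∪w⊆T , dom , spT

  -- The opening move costs one move but leaves spread 0, so the final spread is at most the value
  -- minus one; entering and leaving the final set adds two.
  within-movesFrom+1 : Connected G → ∀ p (a : Acc _⊃_ ⊥) u v →
                       Within (movesFrom G p ⊥ a + 1) u v
  within-movesFrom+1 conn p (acc rs) u v with movesFrom-cases p ⊥ rs
  ... | inj₁ (stuck , _) = ⊥-elim (stuck u (legal-⊥ u))
  ... | inj₂ (w , l , eq) rewrite eq =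
    let T , _ , dom , sp = final-set conn (opponent p) (⊥ ∪ ⁅ w ⁆) (rs (legal⇒⊂ G l))
                             (∈-after ⊥ w) (spread-⁅⁆ w)
    in within-mono (s≤s (≤-reflexive (+-comm 1 _))) (within-dominating sp dom u v)

  -- No extremal pair is chosen: for every `u`, opening at `u` is one of the options over which
  -- Staller maximizes, so its value is a lower bound.
  within-movesFrom-Staller : Connected G → ∀ (a : Acc _⊃_ ⊥) u v →
                             Within (movesFrom G Staller ⊥ a) u v
  within-movesFrom-Staller conn (acc rs) u v =
    let l , i = ∈-values⁺ (legal? G ⊥)
                  (λ w l → movesFrom G Dominator (⊥ ∪ ⁅ w ⁆) (rs (legal⇒⊂ G l)))
                  (allFin order) (∈-allFin u) (legal-⊥ u)
        T , ⊆T , dom , sp = final-set conn Dominator (⊥ ∪ ⁅ u ⁆) (rs (legal⇒⊂ G l))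
                              (∈-after ⊥ u) (spread-⁅⁆ u)
        z , z∈T , zv = dom v
    -- The opening `u` stays in `T`, so only the step from `z` to `v` lies outside the spread bound,
    -- and the opening move pays for it.
    in within-mono (≤-trans (≤-reflexive (+-comm _ 1)) (∈⇒≤-optimal-Staller i))
         (within-trans (sp (⊆T (∈-after ⊥ u)) z∈T) (within-N[] zv))

proposition2p2 : (G : Graph) (conn : Connected G) →
    (diam G conn ≤ γcg G + 1) × (diam G conn ≤ γcg′ G)
proposition2p2 G conn =
  diam-≤ G conn (within-movesFrom+1 G conn Dominator (⊃-wellFounded ⊥)) ,
  diam-≤ G conn (within-movesFrom-Staller G conn (⊃-wellFounded ⊥))
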